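{- Let $d\ge 0$ be an integer, let $G$ be a partial cube of VC-dimension $\le d$, isometrically embedded in $Q_m$, and let $G'$ be obtained from $G$ by an isometric expansion with respect to an isometric cover $(G^1,G^0,G^2)$ of $G$. Then $G'$ is a partial cube of VC-dimension $\le d$ if and only if $G^0$ has VC-dimension $\le d-1$.
   Context: All graphs are finite and simple, and connected (except possibly $G^0$). $Q_m$ has as vertices the subsets of $\{1,\dots,m\}$, adjacent iff their symmetric difference has size $1$. An induced subgraph $H$ of $G$ is isometric if distances in $H$ equal those in $G$. A partial cube is a graph isometrically embeddable in a hypercube; it is identified with its image, an induced subgraph of $Q_m$, hence with a set family. The VC-dimension of a nonempty set family $\mathcal S$ (or of an induced subgraph of a hypercube) is the maximum size of a set $X$ with $\{X\cap S:S\in\mathcal S\}=2^X$. A triplet $(G^1,G^0,G^2)$ is an isometric cover of a connected graph $G$ if $G^1$ and $G^2$ are isometric subgraphs of $G$, $V(G)=V(G^1)\cup V(G^2)$, $E(G)=E(G^1)\cup E(G^2)$, $V(G^1)\cap V(G^2)\neq\varnothing$, and $G^0$ is the subgraph of $G$ induced by $V(G^1)\cap V(G^2)$. The isometric expansion of $G$ with respect to $(G^1,G^0,G^2)$ is the graph obtained by taking disjoint copies of $G^1$ and $G^2$ and adding an edge between the two copies of each vertex of $G^0$. -}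

module Defs where

open import Data.Bool.Base using (true; false)
open import Data.Fin.Base using (Fin)
open import Data.Fin.Subset using (Subset; _∈_; _⊆_; _∩_; _∪_; _─_; ∣_∣; Nonempty)
open import Data.Fin.Subset.Properties using (∪-comm)
open import Data.Integer.Base as ℤ using (ℤ; +_)
open import Data.Nat.Base using (ℕ; zero; suc; _≤_)
open import Data.Product.Base using (Σ; ∃; ∃-syntax; _×_; _,_; proj₁; proj₂)
open import Data.Sum.Base using (_⊎_; inj₁; inj₂)
open import Data.Vec.Base using ([]; _∷_)
open import Function.Bundles using (_⇔_)
open import Relation.Binary.PropositionalEquality using (_≡_; refl; sym; trans; cong)
open import Relation.Nullary using (¬_)

-- Simple graphs on a given vertex type.  Finite graphs are those on Fin n.

record Graph (V : Set) : Set₁ where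
  field
    Adj        : V → V → Set
    Adj-sym    : ∀ {u v} → Adj u v → Adj v u
    Adj-irrefl : ∀ {v} → ¬ Adj v v

open Graph public

data Walk {V : Set} (G : Graph V) : V → V → ℕ → Set where
  nil  : ∀ {v} → Walk G v v zero
  cons : ∀ {u v w k} → Adj G u v → Walk G v w k → Walk G u w (suc k)

Connected : {V : Set} → Graph V → Set
Connected G = ∀ u v → ∃[ k ] Walk G u v k

-- A relation rather than a function, so that it also makes sense (as "no k")
-- for vertices in different components.

Distance : {V : Set} → Graph V → V → V → ℕ → Set
Distance G u v k = Walk G u v k × (∀ l → Walk G u v l → k ≤ l)

-- Preserving distances entails injectivity (distance 0) and that the image
-- is an induced subgraph (distance 1).

Isometric : {V W : Set} → Graph V → Graph W → (V → W) → Set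
Isometric G H f = ∀ u v k → Distance G u v k ⇔ Distance H (f u) (f v) k

infixl 6 _△_

_△_ : ∀ {m} → Subset m → Subset m → Subset m
S △ T = (S ─ T) ∪ (T ─ S)

∣S△S∣≡0 : ∀ {m} (S : Subset m) → ∣ S △ S ∣ ≡ 0
∣S△S∣≡0 []          = refl
∣S△S∣≡0 (true  ∷ S) = ∣S△S∣≡0 S
∣S△S∣≡0 (false ∷ S) = ∣S△S∣≡0 S

Q : (m : ℕ) → Graph (Subset m)
Q m = record
  { Adj        = λ S T → ∣ S △ T ∣ ≡ 1
  ; Adj-sym    = λ {S} {T} e → trans (cong ∣_∣ (∪-comm (T ─ S) (S ─ T))) e
  ; Adj-irrefl = λ {S} e → 0≢1 (trans (sym (∣S△S∣≡0 S)) e)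
  }
  where
  0≢1 : ¬ 0 ≡ 1
  0≢1 ()

induced : ∀ {n} → Graph (Fin n) → (U : Subset n) → Graph (Σ (Fin n) (_∈ U))
induced G U = record
  { Adj        = λ u v → Adj G (proj₁ u) (proj₁ v)
  ; Adj-sym    = Adj-sym G
  ; Adj-irrefl = Adj-irrefl G
  }

-- Isometric subgraphs are induced, so G¹ and G² are given by their vertex
-- sets U₁ and U₂; G⁰ is then induced by U₁ ∩ U₂.

record IsIsometricCover {n} (G : Graph (Fin n)) (U₁ U₂ : Subset n) : Set where
  field
    isometric₁  : Isometric (induced G U₁) G proj₁
    isometric₂  : Isometric (induced G U₂) G proj₁
    vertexCover : ∀ v → v ∈ U₁ ∪ U₂
    edgeCover   : ∀ u v → Adj G u v → (u ∈ U₁ × v ∈ U₁) ⊎ (u ∈ U₂ × v ∈ U₂)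
    nonempty    : Nonempty (U₁ ∩ U₂)

module _ {n} (G : Graph (Fin n)) (U₁ U₂ : Subset n) where

  ExpansionVertex : Set
  ExpansionVertex = Σ (Fin n) (_∈ U₁) ⊎ Σ (Fin n) (_∈ U₂)

  ExpansionAdj : ExpansionVertex → ExpansionVertex → Set
  ExpansionAdj (inj₁ u) (inj₁ v) = Adj (induced G U₁) u v
  ExpansionAdj (inj₂ u) (inj₂ v) = Adj (induced G U₂) u v
  ExpansionAdj (inj₁ u) (inj₂ v) = proj₁ u ≡ proj₁ v
  ExpansionAdj (inj₂ u) (inj₁ v) = proj₁ u ≡ proj₁ v

  expansion : Graph ExpansionVertex
  expansion = record
    { Adj        = ExpansionAdj
    ; Adj-sym    = λ {u} {v} → symm u v
    ; Adj-irrefl = λ {v} → irrefl v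
    }
    where
    symm : ∀ u v → ExpansionAdj u v → ExpansionAdj v u
    symm (inj₁ _) (inj₁ _) = Adj-sym G
    symm (inj₂ _) (inj₂ _) = Adj-sym G
    symm (inj₁ _) (inj₂ _) = sym
    symm (inj₂ _) (inj₁ _) = sym

    irrefl : ∀ v → ¬ ExpansionAdj v v
    irrefl (inj₁ _) = Adj-irrefl G
    irrefl (inj₂ _) = Adj-irrefl G

Family : ℕ → Set₁
Family m = Subset m → Set

image : ∀ {V : Set} {m} → (V → Subset m) → Family m
image φ S = ∃[ v ] φ v ≡ S

-- The inclusion {X ∩ S : S ∈ F} ⊆ 2^X always holds.

Shatters : ∀ {m} → Family m → Subset m → Set
Shatters F X = ∀ Y → Y ⊆ X → ∃[ S ] F S × X ∩ S ≡ Y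

IsVCDim : ∀ {m} → Family m → ℕ → Set
IsVCDim F k = (∃[ X ] Shatters F X × ∣ X ∣ ≡ k) × (∀ X → Shatters F X → ∣ X ∣ ≤ k)

-- The bound is an integer, since it may be -1.

VCDim≤ : ∀ {m} → Family m → ℤ → Set
VCDim≤ F z = ∃[ k ] IsVCDim F k × + k ℤ.≤ z

-- An abstract graph is identified with its image under an isometric embedding
-- into a hypercube.  Connectedness is automatic, since Q m is connected.

IsPartialCubeOfVCDim≤ : {V : Set} → Graph V → ℤ → Set
IsPartialCubeOfVCDim≤ {V} G z =
  ∃[ m ] Σ (V → Subset m) λ φ → Isometric G (Q m) φ × VCDim≤ (image φ) z

{-# OPTIONS --safe #-}

-- The map sending the copy of v in G¹ to φ v and its copy in G² to φ v with
-- one extra element is an isometric embedding of G', because a geodesic of G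
-- from V(G¹) to V(G²) can be chosen to pass through a vertex of G⁰ (a gate).
-- A set X containing the new element is shattered by G' iff X minus that
-- element is shattered by G⁰: given u in G¹ and v in G² with the same trace,
-- a gate on a geodesic between them has this trace as well.
--
-- For the converse one needs that the VC-dimension does not depend on the
-- embedding.  A coordinate that is not constant is flipped by some edge xy,
-- and then it is determined up to complement by the metric alone: its two
-- sides consist of the vertices closer to x and of those closer to y.  So each
-- such coordinate of one embedding is, up to complement, a coordinate of any
-- other one.

module Submission where

open import Defs
open import Data.Bool.Base using (Bool; true; false; _∧_; _xor_)
open import Data.Bool.Properties as Bool
  using (¬-not; not-involutive; xor-assoc; xor-same; xor-identityʳ)
open import Data.Fin.Base using (Fin; zero; suc)
open import Data.Fin.Properties as Fin using (any?)
open import Data.Fin.Subset as Subset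
  using (Subset; _∈_; _⊆_; _∩_; ∣_∣; ⊥; _─_)
open import Data.Fin.Subset.Properties
  using ( _∈?_; _⊆?_; anySubset?; ∣p∣≤n; ∣⊥∣≡0; ∩-zeroˡ; ⊆-antisym; ⊆-min; ∪-comm
        ; out⊆; in⊆in; drop-∷-⊆; x∈p∩q⁺; x∈p∩q⁻; x∈p∧x≢y⇒x∈p-y; x∈p⇒∣p-x∣<∣p∣ )
open import Data.Integer.Base as ℤ using (+_; _-_)
open import Data.Integer.Properties using (drop‿+≤+) renaming (≤-trans to ≤-transℤ)
open import Data.Nat.Base using (ℕ; zero; suc; _+_; _≤_; _<_; z≤n; s≤s; s≤s⁻¹)
open import Data.Nat.Properties as ℕ
  using ( ≤-refl; ≤-reflexive; ≤-trans; ≤-antisym; ≤-<-trans; +-suc; +-mono-≤; m≤n⇒m≤1+n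
        ; n≮n; n<1+n; <⇒≱; ≤∧≢⇒<; suc-injective )
open import Data.Product.Base using (Σ; ∃; ∃-syntax; _×_; _,_; proj₁; proj₂)
open import Data.Sum.Base using (inj₁; inj₂)
open import Data.Vec.Base using ([]; _∷_; lookup; tabulate; here; there)
open import Data.Vec.Properties
  using (≡-dec; []=⇒lookup; lookup⇒[]=; lookup-zipWith; lookup∘tabulate; ∷-injectiveʳ)
open import Function.Base using (_∘_)
open import Function.Bundles using (_⇔_; mk⇔; module Equivalence)
open import Function.Construct.Composition using (_⇔-∘_)
open import Function.Construct.Symmetry using (⇔-sym)
open import Relation.Binary.PropositionalEquality
  using (_≡_; _≢_; refl; sym; trans; cong; cong₂; subst; module ≡-Reasoning)
open import Relation.Nullary
  using (Dec; yes; no; ¬_; contradiction; does; map′; _×-dec_; ¬?)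
open import Relation.Nullary.Decidable using (decidable-stable; dec-true; dec-false)

open Equivalence using (to; from)

private
  variable
    m n k l : ℕ
    V W : Set

-- The Hamming distance

△-triangle : (A C B : Subset m) → ∣ A △ B ∣ ≤ ∣ A △ C ∣ + ∣ C △ B ∣
△-triangle [] [] [] = z≤n
△-triangle (true  ∷ A) (true  ∷ C) (true  ∷ B) = △-triangle A C B
△-triangle (false ∷ A) (false ∷ C) (false ∷ B) = △-triangle A C B
△-triangle (true  ∷ A) (false ∷ C) (true  ∷ B) =
  m≤n⇒m≤1+n (≤-trans (△-triangle A C B) (+-mono-≤ (≤-refl {∣ A △ C ∣}) (ℕ.n≤1+n _)))
△-triangle (false ∷ A) (true  ∷ C) (false ∷ B) =
  m≤n⇒m≤1+n (≤-trans (△-triangle A C B) (+-mono-≤ (≤-refl {∣ A △ C ∣}) (ℕ.n≤1+n _)))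
△-triangle (true  ∷ A) (true  ∷ C) (false ∷ B) =
  ≤-trans (s≤s (△-triangle A C B)) (≤-reflexive (sym (+-suc _ _)))
△-triangle (false ∷ A) (false ∷ C) (true  ∷ B) =
  ≤-trans (s≤s (△-triangle A C B)) (≤-reflexive (sym (+-suc _ _)))
△-triangle (true  ∷ A) (false ∷ C) (false ∷ B) = s≤s (△-triangle A C B)
△-triangle (false ∷ A) (true  ∷ C) (true  ∷ B) = s≤s (△-triangle A C B)

△-comm : (A B : Subset m) → ∣ A △ B ∣ ≡ ∣ B △ A ∣
△-comm A B = cong ∣_∣ (∪-comm (A ─ B) (B ─ A))

∣△∣≡0⇒≡ : (A B : Subset m) → ∣ A △ B ∣ ≡ 0 → A ≡ B
∣△∣≡0⇒≡ [] [] _ = refl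
∣△∣≡0⇒≡ (true  ∷ A) (true  ∷ B) e = cong (true ∷_) (∣△∣≡0⇒≡ A B e)
∣△∣≡0⇒≡ (false ∷ A) (false ∷ B) e = cong (false ∷_) (∣△∣≡0⇒≡ A B e)

-- A coordinate at which `A` and `B` agree but `C` differs adds two to the left-hand side and
-- nothing to the right, which the triangle inequality on the remaining coordinates rules out.
△-between : (A C B : Subset m) → ∣ A △ C ∣ + ∣ C △ B ∣ ≤ ∣ A △ B ∣ →
  ∀ i → lookup A i ≡ lookup B i → lookup C i ≡ lookup A i
△-between (true  ∷ A) (true  ∷ C) (true  ∷ B) le zero    e = refl
△-between (true  ∷ A) (true  ∷ C) (true  ∷ B) le (suc i) e = △-between A C B le i e
△-between (false ∷ A) (false ∷ C) (false ∷ B) le zero    e = refl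
△-between (false ∷ A) (false ∷ C) (false ∷ B) le (suc i) e = △-between A C B le i e
△-between (true  ∷ A) (false ∷ C) (true  ∷ B) le _ _ =
  contradiction (≤-trans le (△-triangle A C B))
    (<⇒≱ (s≤s (+-mono-≤ (≤-refl {∣ A △ C ∣}) (ℕ.n≤1+n _))))
△-between (false ∷ A) (true  ∷ C) (false ∷ B) le _ _ =
  contradiction (≤-trans le (△-triangle A C B))
    (<⇒≱ (s≤s (+-mono-≤ (≤-refl {∣ A △ C ∣}) (ℕ.n≤1+n _))))
△-between (true  ∷ A) (true  ∷ C) (false ∷ B) le (suc i) e =
  △-between A C B (s≤s⁻¹ (≤-trans (≤-reflexive (sym (+-suc _ _))) le)) i e
△-between (false ∷ A) (false ∷ C) (true  ∷ B) le (suc i) e =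
  △-between A C B (s≤s⁻¹ (≤-trans (≤-reflexive (sym (+-suc _ _))) le)) i e
△-between (true  ∷ A) (false ∷ C) (false ∷ B) le (suc i) e = △-between A C B (s≤s⁻¹ le) i e
△-between (false ∷ A) (true  ∷ C) (true  ∷ B) le (suc i) e = △-between A C B (s≤s⁻¹ le) i e

flipped : (A B : Subset m) → ∣ A △ B ∣ ≡ 1 → ∃[ i ] lookup A i ≢ lookup B i
flipped [] [] ()
flipped (true  ∷ A) (false ∷ B) e = zero , λ ()
flipped (false ∷ A) (true  ∷ B) e = zero , λ ()
flipped (true  ∷ A) (true  ∷ B) e = let i , ne = flipped A B e in suc i , ne
flipped (false ∷ A) (false ∷ B) e = let i , ne = flipped A B e in suc i , ne

-- `A` and `B` differ only at `i`, so their distances from `C` differ by exactly one, in favour of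
-- the set that agrees with `C` at `i`.
flipped-side : (A B : Subset m) (i : Fin m) → ∣ A △ B ∣ ≡ 1 → lookup A i ≢ lookup B i →
  ∀ C → lookup C i ≡ lookup A i ⇔ ∣ C △ A ∣ < ∣ C △ B ∣
flipped-side (true  ∷ A) (true  ∷ B) zero e ne C = contradiction refl ne
flipped-side (false ∷ A) (false ∷ B) zero e ne C = contradiction refl ne
flipped-side (true  ∷ A) (false ∷ B) zero e ne (c ∷ C)
  with refl ← ∣△∣≡0⇒≡ A B (suc-injective e) with c
... | true  = mk⇔ (λ _ → ≤-refl) (λ _ → refl)
... | false = mk⇔ (λ ()) (λ lt → contradiction (ℕ.<-trans lt (n<1+n _)) (n≮n _))
flipped-side (false ∷ A) (true  ∷ B) zero e ne (c ∷ C)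
  with refl ← ∣△∣≡0⇒≡ A B (suc-injective e) with c
... | false = mk⇔ (λ _ → ≤-refl) (λ _ → refl)
... | true  = mk⇔ (λ ()) (λ lt → contradiction (ℕ.<-trans lt (n<1+n _)) (n≮n _))
flipped-side (true  ∷ A) (false ∷ B) (suc i) e ne C =
  contradiction (cong (λ S → lookup S i) (∣△∣≡0⇒≡ A B (suc-injective e))) ne
flipped-side (false ∷ A) (true  ∷ B) (suc i) e ne C =
  contradiction (cong (λ S → lookup S i) (∣△∣≡0⇒≡ A B (suc-injective e))) ne
flipped-side (true  ∷ A) (true  ∷ B) (suc i) e ne (true  ∷ C) = flipped-side A B i e ne C
flipped-side (false ∷ A) (false ∷ B) (suc i) e ne (false ∷ C) = flipped-side A B i e ne C
flipped-side (true  ∷ A) (true  ∷ B) (suc i) e ne (false ∷ C) =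
  mk⇔ s≤s s≤s⁻¹ ⇔-∘ flipped-side A B i e ne C
flipped-side (false ∷ A) (false ∷ B) (suc i) e ne (true  ∷ C) =
  mk⇔ s≤s s≤s⁻¹ ⇔-∘ flipped-side A B i e ne C

-- Walks and distances

mapWalk : (G : Graph V) (H : Graph W) (f : V → W) →
  (∀ {x y} → Adj G x y → Adj H (f x) (f y)) →
  ∀ {u v} → Walk G u v k → Walk H (f u) (f v) k
mapWalk G H f adj nil        = nil
mapWalk G H f adj (cons a w) = cons (adj a) (mapWalk G H f adj w)

_++ʷ_ : {G : Graph V} {u v w : V} → Walk G u v k → Walk G v w l → Walk G u w (k + l)
nil      ++ʷ q = q
cons a p ++ʷ q = cons a (p ++ʷ q)

snoc : (G : Graph V) {u v w : V} → Walk G u v k → Adj G v w → Walk G u w (suc k)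
snoc G nil        b = cons b nil
snoc G (cons a p) b = cons a (snoc G p b)

reverse : (G : Graph V) {u v : V} → Walk G u v k → Walk G v u k
reverse G nil        = nil
reverse G (cons a p) = snoc G (reverse G p) (Adj-sym G a)

distance-unique : {G : Graph V} {u v : V} → Distance G u v k → Distance G u v l → k ≡ l
distance-unique (p , p-min) (q , q-min) = ≤-antisym (p-min _ q) (q-min _ p)

adj⇒distance≡1 : (G : Graph V) {u v : V} → Adj G u v → Distance G u v k → k ≡ 1
adj⇒distance≡1 G a (nil                , _)   = contradiction a (Adj-irrefl G)
adj⇒distance≡1 G a (cons _ nil         , _)   = refl
adj⇒distance≡1 G a (cons _ (cons _ _) , min) with s≤s () ← min 1 (cons a nil)

hypercube-walk : (S T : Subset m) → Walk (Q m) S T ∣ S △ T ∣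
hypercube-walk [] [] = nil
hypercube-walk {suc m} (true  ∷ S) (true  ∷ T) =
  mapWalk (Q m) (Q (suc m)) (true ∷_) (λ a → a) (hypercube-walk S T)
hypercube-walk {suc m} (false ∷ S) (false ∷ T) =
  mapWalk (Q m) (Q (suc m)) (false ∷_) (λ a → a) (hypercube-walk S T)
hypercube-walk {suc m} (true  ∷ S) (false ∷ T) =
  cons (cong suc (∣S△S∣≡0 S))
    (mapWalk (Q m) (Q (suc m)) (false ∷_) (λ a → a) (hypercube-walk S T))
hypercube-walk {suc m} (false ∷ S) (true  ∷ T) =
  cons (cong suc (∣S△S∣≡0 S))
    (mapWalk (Q m) (Q (suc m)) (true ∷_) (λ a → a) (hypercube-walk S T))

∣△∣≤walk : {S T : Subset m} → Walk (Q m) S T l → ∣ S △ T ∣ ≤ l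
∣△∣≤walk {S = S} nil = ≤-reflexive (∣S△S∣≡0 S)
∣△∣≤walk {S = S} {T} (cons {v = R} a p) =
  ≤-trans (△-triangle S R T) (+-mono-≤ (≤-reflexive a) (∣△∣≤walk p))

hypercube-distance : (S T : Subset m) → Distance (Q m) S T ∣ S △ T ∣
hypercube-distance S T = hypercube-walk S T , λ _ → ∣△∣≤walk

isometric⇒distance : (G : Graph V) (φ : V → Subset m) → Isometric G (Q m) φ →
  ∀ u v → Distance G u v ∣ φ u △ φ v ∣
isometric⇒distance G φ iso u v = from (iso u v _) (hypercube-distance (φ u) (φ v))

isometric⇒adj : (G : Graph V) (φ : V → Subset m) → Isometric G (Q m) φ →
  ∀ {u v} → Adj G u v → Adj (Q m) (φ u) (φ v)
isometric⇒adj G φ iso {u} {v} a = adj⇒distance≡1 G a (isometric⇒distance G φ iso u v)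

-- Preserving adjacency makes the Hamming distance a lower bound for the length of every walk, so
-- the given walk is shortest. Distances being unique, this one value settles both directions.
isometric⁺ : (G : Graph V) (φ : V → Subset m) →
  (∀ {u v} → Adj G u v → Adj (Q m) (φ u) (φ v)) →
  (∀ u v → Walk G u v ∣ φ u △ φ v ∣) →
  Isometric G (Q m) φ
isometric⁺ {m = m} G φ adj walk u v k = mk⇔
  (λ δ → subst (Distance (Q m) (φ u) (φ v)) (distance-unique dist δ)
                 (hypercube-distance (φ u) (φ v)))
  (λ δ → subst (Distance G u v)
                 (distance-unique (hypercube-distance (φ u) (φ v)) δ) dist)
  where
  dist : Distance G u v ∣ φ u △ φ v ∣
  dist = walk u v , λ _ p → ∣△∣≤walk (mapWalk G (Q m) φ adj p)

-- Shattering

-- Coordinates are listed by a function instead of a subset, so that each can be replaced by a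
-- coordinate of another embedding without regard to their order.
ShattersAlong : (V → Subset m) → (Fin k → Fin m) → Set
ShattersAlong {k = k} φ f =
  (p : Fin k → Bool) → ∃[ v ] ∀ i → lookup (φ v) (f i) ≡ p i

enum : (X : Subset m) → Fin ∣ X ∣ → Fin m
enum (true  ∷ X) zero    = zero
enum (true  ∷ X) (suc i) = suc (enum X i)
enum (false ∷ X) i       = suc (enum X i)

scatter : (X : Subset m) → (Fin ∣ X ∣ → Bool) → Subset m
scatter []          p = []
scatter (true  ∷ X) p = p zero ∷ scatter X (p ∘ suc)
scatter (false ∷ X) p = false ∷ scatter X p

scatter-⊆ : (X : Subset m) (p : Fin ∣ X ∣ → Bool) → scatter X p ⊆ X
scatter-⊆ (true  ∷ X) p {zero} _  = here
scatter-⊆ (true  ∷ X) p (there x) = there (scatter-⊆ X (p ∘ suc) x)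
scatter-⊆ (false ∷ X) p (there x) = there (scatter-⊆ X p x)

lookup-scatter : (X S : Subset m) (p : Fin ∣ X ∣ → Bool) → X ∩ S ≡ scatter X p →
  ∀ i → lookup S (enum X i) ≡ p i
lookup-scatter (true  ∷ X) (s ∷ S) p e zero    = cong (λ T → lookup T zero) e
lookup-scatter (true  ∷ X) (s ∷ S) p e (suc i) =
  lookup-scatter X S (p ∘ suc) (∷-injectiveʳ e) i
lookup-scatter (false ∷ X) (s ∷ S) p e i       = lookup-scatter X S p (∷-injectiveʳ e) i

shatters⇒along : (φ : V → Subset m) (X : Subset m) →
  Shatters (image φ) X → ShattersAlong φ (enum X)
shatters⇒along φ X sh p with sh (scatter X p) (scatter-⊆ X p)
... | _ , (v , refl) , e = v , lookup-scatter X (φ v) p e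

-- The pattern that is true at `i` alone separates `i` from any other index.
along-injective : (φ : V → Subset m) (f : Fin k → Fin m) → ShattersAlong φ f →
  ∀ {i j} → f i ≡ f j → i ≡ j
along-injective φ f sh {i} {j} fi≡fj with sh (λ l → does (l Fin.≟ i))
... | v , e = decidable-stable (i Fin.≟ j) λ i≢j → true≢false (begin
  true                ≡⟨ dec-true (i Fin.≟ i) refl ⟨
  does (i Fin.≟ i)    ≡⟨ e i ⟨
  lookup (φ v) (f i)  ≡⟨ cong (lookup (φ v)) fi≡fj ⟩
  lookup (φ v) (f j)  ≡⟨ e j ⟩
  does (j Fin.≟ i)    ≡⟨ dec-false (j Fin.≟ i) (i≢j ∘ sym) ⟩
  false               ∎)
  where
  open ≡-Reasoning
  true≢false : true ≢ false
  true≢false ()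

range : (Fin k → Fin m) → Subset m
range f = tabulate λ j → does (any? λ i → f i Fin.≟ j)

∈-range⁺ : (f : Fin k → Fin m) (i : Fin k) → f i ∈ range f
∈-range⁺ f i = lookup⇒[]= (f i) (range f)
  (trans (lookup∘tabulate _ (f i)) (dec-true (any? λ i′ → f i′ Fin.≟ f i) (i , refl)))

∈-range⁻ : (f : Fin k → Fin m) {j : Fin m} → j ∈ range f → ∃[ i ] f i ≡ j
∈-range⁻ f {j} j∈ with any? (λ i → f i Fin.≟ j) | trans (sym (lookup∘tabulate _ j)) ([]=⇒lookup j∈)
... | yes r | _  = r
... | no  _ | ()

-- Induction on `k`: removing `f zero` from `X` lowers its size, and by injectivity the remaining
-- values stay inside.
injective⇒≤∣∣ : (f : Fin k → Fin m) (X : Subset m) → (∀ {i j} → f i ≡ f j → i ≡ j) →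
  (∀ i → f i ∈ X) → k ≤ ∣ X ∣
injective⇒≤∣∣ {zero}  f X inj f∈X = z≤n
injective⇒≤∣∣ {suc k} f X inj f∈X =
  ≤-<-trans
    (injective⇒≤∣∣ (f ∘ suc) (X Subset.- f zero) (Fin.suc-injective ∘ inj)
      (λ i → x∈p∧x≢y⇒x∈p-y (f∈X (suc i)) λ e → Fin.0≢1+n (inj (sym e))))
    (x∈p⇒∣p-x∣<∣p∣ (f∈X zero))

∩≡⁺ : (X S Y : Subset m) → Y ⊆ X → (∀ {j} → j ∈ X → lookup S j ≡ lookup Y j) → X ∩ S ≡ Y
∩≡⁺ X S Y Y⊆X e = ⊆-antisym
  (λ {j} j∈ → let j∈X , j∈S = x∈p∩q⁻ X S j∈ in
    lookup⇒[]= j Y (trans (sym (e j∈X)) ([]=⇒lookup j∈S)))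
  (λ {j} j∈Y → x∈p∩q⁺ (Y⊆X j∈Y , lookup⇒[]= j S (trans (e (Y⊆X j∈Y)) ([]=⇒lookup j∈Y))))

∩≡⁻ : (X S Y : Subset m) → X ∩ S ≡ Y → ∀ {j} → j ∈ X → lookup S j ≡ lookup Y j
∩≡⁻ X S _ refl {j} j∈X =
  sym (trans (lookup-zipWith _∧_ j X S) (cong (_∧ lookup S j) ([]=⇒lookup j∈X)))

along⇒shatters : (φ : V → Subset m) (f : Fin k → Fin m) →
  ShattersAlong φ f → Shatters (image φ) (range f)
along⇒shatters φ f sh Y Y⊆ with sh (lookup Y ∘ f)
... | v , e = φ v , (v , refl) , ∩≡⁺ (range f) (φ v) Y Y⊆ λ j∈ → lemma (∈-range⁻ f j∈)
  where
  lemma : ∀ {j} → ∃[ i ] f i ≡ j → lookup (φ v) j ≡ lookup Y j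
  lemma (i , refl) = e i

along⇒≤ : (φ : V → Subset m) (f : Fin k → Fin m) → ShattersAlong φ f →
  (∀ X → Shatters (image φ) X → ∣ X ∣ ≤ l) → k ≤ l
along⇒≤ φ f sh bound =
  ≤-trans (injective⇒≤∣∣ f (range f) (along-injective φ f sh) (∈-range⁺ f))
          (bound (range f) (along⇒shatters φ f sh))

-- Independence of the embedding

-- The edge is the first one of the walk along which coordinate `i` changes; if there were none, the
-- two ends would agree.
flipped-edge : (G : Graph V) (φ : V → Subset m) (i : Fin m) {u v : V} →
  Walk G u v k → lookup (φ u) i ≢ lookup (φ v) i →
  ∃[ x ] ∃[ y ] Adj G x y × lookup (φ x) i ≢ lookup (φ y) i
flipped-edge G φ i nil ne = contradiction refl ne
flipped-edge G φ i {u} (cons {v = w} a p) ne with lookup (φ u) i Bool.≟ lookup (φ w) i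
... | yes e   = flipped-edge G φ i p (ne ∘ trans e)
... | no  ne′ = u , w , a , ne′

-- Here `a` and `c` stand for two coordinates at a variable vertex, `b` and `d` for the same
-- coordinates at a fixed one. The constant `b xor d` records whether one coordinate is the
-- complement of the other.
≡-xor : ∀ a b c d → (a ≡ b ⇔ c ≡ d) → c ≡ a xor (b xor d)
≡-xor true  true  c d eq = trans (to eq refl) (sym (not-involutive d))
≡-xor false false c d eq = to eq refl
≡-xor true  false c d eq = ¬-not λ e → contradiction (from eq e) λ ()
≡-xor false true  c d eq = ¬-not λ e → contradiction (from eq e) λ ()

coordinate-transfer : (G : Graph V) (φ : V → Subset m) (ψ : V → Subset n) →
  Isometric G (Q m) φ → Isometric G (Q n) ψ →
  ∀ i {u v} → lookup (φ u) i ≢ lookup (φ v) i →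
  ∃[ j ] ∃[ c ] ∀ z → lookup (ψ z) j ≡ lookup (φ z) i xor c
coordinate-transfer G φ ψ iso-φ iso-ψ i {u} {v} ne
  with flipped-edge G φ i (proj₁ (isometric⇒distance G φ iso-φ u v)) ne
-- `ψ` maps edges to edges, so the edge from `x` to `y` also flips some coordinate `j` of `ψ`.
... | x , y , a , ne-i with flipped (ψ x) (ψ y) (isometric⇒adj G ψ iso-ψ a)
... | j , ne-j = j , lookup (φ x) i xor lookup (ψ x) j , λ z →
  ≡-xor _ _ _ _
    (⇔-sym (flipped-side (ψ x) (ψ y) j (isometric⇒adj G ψ iso-ψ a) ne-j (ψ z))
      ⇔-∘ subst (λ t → _ ⇔ t) (cong₂ _<_ (same z x) (same z y))
            (flipped-side (φ x) (φ y) i (isometric⇒adj G φ iso-φ a) ne-i (φ z)))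
  where
  same : ∀ p q → ∣ φ p △ φ q ∣ ≡ ∣ ψ p △ ψ q ∣
  same p q =
    distance-unique (isometric⇒distance G φ iso-φ p q) (isometric⇒distance G ψ iso-ψ p q)

along-transfer : (G : Graph V) (φ : V → Subset m) (ψ : V → Subset n) →
  Isometric G (Q m) φ → Isometric G (Q n) ψ →
  (f : Fin k → Fin m) → ShattersAlong φ f → ∃[ g ] ShattersAlong {k = k} ψ g
along-transfer {k = k} G φ ψ iso-φ iso-ψ f sh = proj₁ ∘ coord , λ p →
  -- Requesting the pattern already twisted by `c` makes the two complementations cancel.
  let z , e = sh (λ i → p i xor c i) in
  z , λ i → begin
    lookup (ψ z) (proj₁ (coord i))  ≡⟨ proj₂ (proj₂ (coord i)) z ⟩
    lookup (φ z) (f i) xor c i      ≡⟨ cong (_xor c i) (e i) ⟩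
    (p i xor c i) xor c i           ≡⟨ xor-assoc (p i) (c i) (c i) ⟩
    p i xor (c i xor c i)           ≡⟨ cong (p i xor_) (xor-same (c i)) ⟩
    p i xor false                   ≡⟨ xor-identityʳ (p i) ⟩
    p i                             ∎
  where
  open ≡-Reasoning
  coord : ∀ i → ∃[ j ] ∃[ c ] ∀ z → lookup (ψ z) j ≡ lookup (φ z) (f i) xor c
  -- The all-true and all-false patterns supply two vertices that show coordinate `f i` to be
  -- non-constant.
  coord i with sh (λ _ → true) | sh (λ _ → false)
  ... | u , u≡true | v , v≡false = coordinate-transfer G φ ψ iso-φ iso-ψ (f i) {u} {v}
    λ e → contradiction (trans (sym (u≡true i)) (trans e (v≡false i))) λ ()
  c : Fin k → Bool
  c i = proj₁ (proj₂ (coord i))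

-- This moves a bound known for an arbitrary embedding of the expansion to the explicit one.
shatters⇒≤ : (G : Graph V) (φ : V → Subset m) (ψ : V → Subset n) →
  Isometric G (Q m) φ → Isometric G (Q n) ψ →
  (∀ X → Shatters (image ψ) X → ∣ X ∣ ≤ l) → ∀ X → Shatters (image φ) X → ∣ X ∣ ≤ l
shatters⇒≤ G φ ψ iso-φ iso-ψ bound X sh =
  let g , sh′ = along-transfer G φ ψ iso-φ iso-ψ (enum X) (shatters⇒along φ X sh)
  in along⇒≤ ψ g sh′ bound

-- Existence of the VC-dimension

-- A finite search looks for a subset of `X` that is not a trace. Being a trace is decidable, so a
-- failed search yields actual witnesses.
shatters? : {F : Family m} → (∀ S → Dec (F S)) → ∀ X → Dec (Shatters F X)
shatters? {m} {F} F? X =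
  map′ ¬missed⇒shatters (λ { sh (Y , Y⊆X , ¬t) → ¬t (sh Y Y⊆X) }) (¬? (anySubset? missed?))
  where
  Trace Missed : Subset m → Set
  Trace Y  = ∃[ S ] F S × X ∩ S ≡ Y
  Missed Y = Y ⊆ X × ¬ Trace Y

  trace? : ∀ Y → Dec (Trace Y)
  trace? Y = anySubset? λ S → F? S ×-dec ≡-dec Bool._≟_ (X ∩ S) Y

  missed? : ∀ Y → Dec (Missed Y)
  missed? Y = Y ⊆? X ×-dec ¬? (trace? Y)

  ¬missed⇒shatters : ¬ ∃ Missed → Shatters F X
  ¬missed⇒shatters ¬missed Y Y⊆X =
    decidable-stable (trace? Y) λ ¬t → ¬missed (Y , Y⊆X , ¬t)

shatters-⊥ : {F : Family m} → ∃ F → Shatters F ⊥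
shatters-⊥ (S , FS) Y Y⊆⊥ = S , FS , trans (∩-zeroˡ S) (⊆-antisym (⊆-min Y) Y⊆⊥)

-- The trivial bound `m` is lowered until some shattered set attains it. At the latest this happens
-- at 0, where the empty set attains it because `F` is nonempty.
vcDim-exists : {F : Family m} → (∀ S → Dec (F S)) → ∃ F → ∃ (IsVCDim F)
vcDim-exists {m} {F} F? ne = go m λ X _ → ∣p∣≤n X
  where
  go : ∀ c → (∀ X → Shatters F X → ∣ X ∣ ≤ c) → ∃ (IsVCDim F)
  go zero    bound = 0 , (⊥ , shatters-⊥ ne , ∣⊥∣≡0 m) , bound
  go (suc c) bound with anySubset? (λ X → shatters? F? X ×-dec ∣ X ∣ ℕ.≟ suc c)
  ... | yes w  = suc c , w , bound
  ... | no  ¬w = go c λ X sh → s≤s⁻¹ (≤∧≢⇒< (bound X sh) λ e → ¬w (X , sh , e))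

-- The VC-dimension is itself the size of a shattered set, so the bound applies to it directly.
vcDim≤⁺ : {F : Family m} (z : ℤ.ℤ) → (∀ S → Dec (F S)) → ∃ F →
  (∀ X → Shatters F X → + ∣ X ∣ ℤ.≤ z) → VCDim≤ F z
vcDim≤⁺ z F? ne bound with vcDim-exists F? ne
... | k , vc@((X , sh , refl) , _) = k , vc , bound X sh

vcDim≤⁻ : {F : Family m} (z : ℤ.ℤ) → VCDim≤ F z → ∀ X → Shatters F X → + ∣ X ∣ ℤ.≤ z
vcDim≤⁻ z (k , (_ , max) , k≤z) X sh = ≤-transℤ (ℤ.+≤+ (max X sh)) k≤z

image-restrict? : (φ : Fin n → Subset m) (U : Subset n) →
  ∀ S → Dec (image {V = Σ (Fin n) (_∈ U)} (φ ∘ proj₁) S)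
image-restrict? φ U S = map′
  (λ { (v , v∈U , e) → (v , v∈U) , e })
  (λ { ((v , v∈U) , e) → v , v∈U , e })
  (any? λ v → v ∈? U ×-dec ≡-dec Bool._≟_ (φ v) S)

≤-1⁺ : ∀ {k d} → suc k ≤ d → + k ℤ.≤ + d - + 1
≤-1⁺ (s≤s k≤d) = ℤ.+≤+ k≤d

≤-1⁻ : ∀ {k} d → + k ℤ.≤ + d - + 1 → suc k ≤ d
-- For `d` equal to 0 the bound is -1, which lies below every natural number, so that case is empty.
≤-1⁻ (suc d) (ℤ.+≤+ k≤d) = s≤s k≤d

-- The expansion

module _ {n m} (G : Graph (Fin n)) (φ : Fin n → Subset m) (iso : Isometric G (Q m) φ)
         (U₁ U₂ : Subset n) (cover : IsIsometricCover G U₁ U₂) where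

  open IsIsometricCover cover

  private
    G′ = expansion G U₁ U₂
    φ₀ = image {V = Σ (Fin n) (_∈ U₁ ∩ U₂)} (φ ∘ proj₁)

  φ′ : ExpansionVertex G U₁ U₂ → Subset (suc m)
  φ′ (inj₁ (u , _)) = false ∷ φ u
  φ′ (inj₂ (u , _)) = true  ∷ φ u

  -- As every edge lies in G¹ or in G², a walk from `U₁` to `U₂` cannot leave `U₁` before reaching a
  -- vertex of both. Allowing walks of any length makes induction possible; on a geodesic the
  -- inequality becomes tight.
  walk-gate : ∀ {u v k} → u ∈ U₁ → v ∈ U₂ → Walk G u v k →
    ∃[ w ] w ∈ U₁ × w ∈ U₂ × ∣ φ u △ φ w ∣ + ∣ φ w △ φ v ∣ ≤ k
  walk-gate {u} u∈U₁ v∈U₂ nil =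
    u , u∈U₁ , v∈U₂ , ≤-reflexive (cong₂ _+_ (∣S△S∣≡0 (φ u)) (∣S△S∣≡0 (φ u)))
  walk-gate {u} {v} u∈U₁ v∈U₂ p@(cons {v = x} a q) with edgeCover _ _ a
  -- The first edge lies in G², so `u` itself is the gate, at distance 0 from itself.
  ... | inj₂ (u∈U₂ , _) = u , u∈U₁ , u∈U₂ ,
    subst (λ t → t + ∣ φ u △ φ v ∣ ≤ _) (sym (∣S△S∣≡0 (φ u)))
      (proj₂ (isometric⇒distance G φ iso u v) _ p)
  ... | inj₁ (_ , x∈U₁) with walk-gate x∈U₁ v∈U₂ q
  ... | w , w∈U₁ , w∈U₂ , le = w , w∈U₁ , w∈U₂ ,
    ≤-trans (+-mono-≤ (△-triangle (φ u) (φ x) (φ w)) ≤-refl)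
      (subst (λ t → t + ∣ φ x △ φ w ∣ + ∣ φ w △ φ v ∣ ≤ _)
             (sym (isometric⇒adj G φ iso a)) (s≤s le))

  gate : ∀ {u v} → u ∈ U₁ → v ∈ U₂ →
    ∃[ w ] w ∈ U₁ × w ∈ U₂ × ∣ φ u △ φ w ∣ + ∣ φ w △ φ v ∣ ≤ ∣ φ u △ φ v ∣
  gate {u} {v} u∈U₁ v∈U₂ =
    walk-gate u∈U₁ v∈U₂ (proj₁ (isometric⇒distance G φ iso u v))

  φ′-adj : ∀ {x y} → Adj G′ x y → Adj (Q (suc m)) (φ′ x) (φ′ y)
  φ′-adj {inj₁ _} {inj₁ _} a = isometric⇒adj G φ iso a
  φ′-adj {inj₂ _} {inj₂ _} a = isometric⇒adj G φ iso a
  φ′-adj {inj₁ (u , _)} {inj₂ _} refl = cong suc (∣S△S∣≡0 (φ u))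
  φ′-adj {inj₂ (u , _)} {inj₁ _} refl = cong suc (∣S△S∣≡0 (φ u))

  -- Since G¹ is isometric in `G`, some geodesic of `G` between two of its vertices stays inside it.
  walk₁ : ∀ u v → Walk G′ (inj₁ u) (inj₁ v) ∣ φ (proj₁ u) △ φ (proj₁ v) ∣
  walk₁ u v = mapWalk (induced G U₁) G′ inj₁ (λ a → a)
    (proj₁ (from (isometric₁ u v _) (isometric⇒distance G φ iso _ _)))

  walk₂ : ∀ u v → Walk G′ (inj₂ u) (inj₂ v) ∣ φ (proj₁ u) △ φ (proj₁ v) ∣
  walk₂ u v = mapWalk (induced G U₂) G′ inj₂ (λ a → a)
    (proj₁ (from (isometric₂ u v _) (isometric⇒distance G φ iso _ _)))

  -- The walk changes copies at a gate. The two distances to the gate add up to the distance in `G`,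
  -- and the new edge contributes the extra one.
  walk₁₂ : ∀ u v → Walk G′ (inj₁ u) (inj₂ v) (suc ∣ φ (proj₁ u) △ φ (proj₁ v) ∣)
  walk₁₂ (u , u∈U₁) (v , v∈U₂) with gate u∈U₁ v∈U₂
  ... | w , w∈U₁ , w∈U₂ , le =
    subst (Walk G′ _ _)
      (trans (+-suc _ _) (cong suc (≤-antisym le (△-triangle (φ u) (φ w) (φ v)))))
      (walk₁ (u , u∈U₁) (w , w∈U₁) ++ʷ cons refl (walk₂ (w , w∈U₂) (v , v∈U₂)))

  φ′-walk : ∀ x y → Walk G′ x y ∣ φ′ x △ φ′ y ∣
  φ′-walk (inj₁ u) (inj₁ v) = walk₁ u v
  φ′-walk (inj₂ u) (inj₂ v) = walk₂ u v
  φ′-walk (inj₁ u) (inj₂ v) = walk₁₂ u v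
  φ′-walk (inj₂ u) (inj₁ v) =
    subst (Walk G′ (inj₂ u) (inj₁ v) ∘ suc) (△-comm (φ (proj₁ v)) (φ (proj₁ u)))
      (reverse G′ (walk₁₂ v u))

  φ′-isometric : Isometric G′ (Q (suc m)) φ′
  φ′-isometric = isometric⁺ G′ φ′ (λ {x} {y} → φ′-adj {x} {y}) φ′-walk

  image-φ′? : ∀ S → Dec (image φ′ S)
  image-φ′? (false ∷ S) = map′
    (λ { (u , refl) → inj₁ u , refl }) (λ { (inj₁ u , refl) → u , refl })
    (image-restrict? φ U₁ S)
  image-φ′? (true ∷ S) = map′
    (λ { (u , refl) → inj₂ u , refl }) (λ { (inj₂ u , refl) → u , refl })
    (image-restrict? φ U₂ S)

  image-φ₀-nonempty : ∃ φ₀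
  image-φ₀-nonempty = _ , nonempty , refl

  image-φ′-nonempty : ∃ (image φ′)
  image-φ′-nonempty =
    _ , inj₁ (proj₁ nonempty , proj₁ (x∈p∩q⁻ U₁ U₂ (proj₂ nonempty))) , refl

  -- A vertex of G⁰ has a copy on each side, so its trace on `X` occurs with both values of the new
  -- coordinate.
  shatters-φ₀⇒φ′ : ∀ X → Shatters φ₀ X → Shatters (image φ′) (true ∷ X)
  shatters-φ₀⇒φ′ X sh (b ∷ Y) Y⊆X with sh Y (drop-∷-⊆ Y⊆X)
  ... | _ , ((v , v∈U) , refl) , e with b
  ... | true  = _ , (inj₂ (v , proj₂ (x∈p∩q⁻ U₁ U₂ v∈U)) , refl) , cong (true ∷_) e
  ... | false = _ , (inj₁ (v , proj₁ (x∈p∩q⁻ U₁ U₂ v∈U)) , refl) , cong (false ∷_) e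

  shatters-φ′⇒φ : ∀ X → Shatters (image φ′) (false ∷ X) → Shatters (image φ) X
  shatters-φ′⇒φ X sh Y Y⊆X with sh (false ∷ Y) (out⊆ Y⊆X)
  ... | _ , (inj₁ (v , _) , refl) , e = φ v , (v , refl) , ∷-injectiveʳ e
  ... | _ , (inj₂ (v , _) , refl) , e = φ v , (v , refl) , ∷-injectiveʳ e

  shatters-φ′⇒φ₀ : ∀ X → Shatters (image φ′) (true ∷ X) → Shatters φ₀ X
  shatters-φ′⇒φ₀ X sh Y Y⊆X
    -- Requesting `Y` without and with the new element forces a vertex in the copy of G¹ and one in
    -- the copy of G².
    with sh (false ∷ Y) (out⊆ Y⊆X) | sh (true ∷ Y) (in⊆in Y⊆X)
  ... | _ , (inj₁ (u , u∈U₁) , refl) , eᵤ | _ , (inj₂ (v , v∈U₂) , refl) , eᵥ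
    with gate u∈U₁ v∈U₂
  ... | w , w∈U₁ , w∈U₂ , le =
    φ w , ((w , x∈p∩q⁺ (w∈U₁ , w∈U₂)) , refl) , ∩≡⁺ X (φ w) Y Y⊆X λ {j} j∈X →
      let u≡Y = ∩≡⁻ X (φ u) Y (∷-injectiveʳ eᵤ) j∈X
          v≡Y = ∩≡⁻ X (φ v) Y (∷-injectiveʳ eᵥ) j∈X
      in trans (△-between (φ u) (φ w) (φ v) le j (trans u≡Y (sym v≡Y))) u≡Y

proposition15 : (d m n : ℕ) (G : Graph (Fin n)) → Connected G →
    (φ : Fin n → Subset m) → Isometric G (Q m) φ → VCDim≤ (image φ) (+ d) →
    (U₁ U₂ : Subset n) → IsIsometricCover G U₁ U₂ →
    IsPartialCubeOfVCDim≤ (expansion G U₁ U₂) (+ d)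
    ⇔ VCDim≤ (image {V = Σ (Fin n) (λ v → v ∈ U₁ ∩ U₂)} (φ ∘ proj₁)) (+ d - + 1)
proposition15 d m n G _ φ iso vc U₁ U₂ cover = mk⇔ only-if if
  where
  G′ = expansion G U₁ U₂
  Φ  = φ′ G φ iso U₁ U₂ cover
  Φ-isometric = φ′-isometric G φ iso U₁ U₂ cover

  only-if : IsPartialCubeOfVCDim≤ G′ (+ d) →
    VCDim≤ (image {V = Σ (Fin n) (_∈ U₁ ∩ U₂)} (φ ∘ proj₁)) (+ d - + 1)
  only-if (M , ψ , iso-ψ , vc-ψ) =
    vcDim≤⁺ _ (image-restrict? φ (U₁ ∩ U₂)) (image-φ₀-nonempty G φ iso U₁ U₂ cover) λ X sh →
      -- Adding the new element to `X` raises its size by one, which accounts for the drop from `d`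
      -- to `d - 1`.
      ≤-1⁺ (shatters⇒≤ G′ Φ ψ Φ-isometric iso-ψ
        (λ Y → drop‿+≤+ ∘ vcDim≤⁻ (+ d) vc-ψ Y)
        (true ∷ X) (shatters-φ₀⇒φ′ G φ iso U₁ U₂ cover X sh))

  if : VCDim≤ (image {V = Σ (Fin n) (_∈ U₁ ∩ U₂)} (φ ∘ proj₁)) (+ d - + 1) →
    IsPartialCubeOfVCDim≤ G′ (+ d)
  if vc₀ = suc m , Φ , Φ-isometric ,
    -- A shattered set with the new element is bounded through G⁰, one without it through the bound
    -- on `G`.
    vcDim≤⁺ _ (image-φ′? G φ iso U₁ U₂ cover) (image-φ′-nonempty G φ iso U₁ U₂ cover) λ
      { (true ∷ X) sh →
          ℤ.+≤+ (≤-1⁻ d (vcDim≤⁻ _ vc₀ X (shatters-φ′⇒φ₀ G φ iso U₁ U₂ cover X sh)))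
      ; (false ∷ X) sh → vcDim≤⁻ _ vc X (shatters-φ′⇒φ G φ iso U₁ U₂ cover X sh)
      }
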